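{- Let $T=\{t_1,\ldots,t_N\}$ be documents containing words from a dictionary $\{w_1,\ldots,w_D\}$, and let $\#(w)$ denote the number of documents containing word $w$. Let $h_1,\ldots,h_k$ be hash functions whose values $h_j(t)$ are independent and uniform on $[0,1]$. Consider the mapper MinHashSampleMap which, for each document $t$, each word $w$ in $t$, and each $j=1,\ldots,k$, emits $((w,j)\to h_j(t))$ if and only if $h_j(t)\le\frac{c\log(Dk)}{\#(w)}$, where $c=3$. Then the expected total number of emitted key-value pairs (shuffle size) is at most $cDk\log(Dk)=O(Dk\log(Dk))$; in particular, with $k=1/\epsilon$ for $\epsilon\in(0,1]$, it is $O((D/\epsilon)\log(D/\epsilon))$.
   Context: $\log$ denotes the natural logarithm. The shuffle size is the total number of key-value pairs emitted by all mappers. -}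

module Defs where

open import Level using (0ℓ) renaming (suc to lsuc)
open import Axiom.ExcludedMiddle using (ExcludedMiddle)
open import Algebra.Bundles using (CommutativeRing)
open import Algebra.Structures using (IsCommutativeRing)
import Algebra.Definitions.RawMonoid as RawMonoidOps
open import Data.Fin.Base using (Fin; toℕ)
open import Data.Fin.Subset using (Subset; _∈_)
open import Data.Fin.Subset.Properties using (_∈?_)
open import Data.List.Base
  using (List; allFin; cartesianProduct; concatMap; filter; length; map)
open import Data.Nat.Base as ℕ using (ℕ; NonZero)
open import Data.Product.Base using (_×_; _,_; ∃; ∃-syntax)
open import Data.Sum.Base using (inj₁; inj₂)
open import Relation.Binary.Core using (Rel)
open import Relation.Binary.Structures using (IsTotalOrder)
open import Relation.Binary.PropositionalEquality.Core using (_≡_; _≢_)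
import Relation.Binary.Construct.NonStrictToStrict as ToStrict
open import Relation.Nullary using (¬_; yes; no)
open import Relation.Nullary.Decidable using (_×-dec_)
open import Relation.Unary using (Pred; U; ∁; ⋃; _≐_; _⊥_; _⊢_)

-- The real numbers, characterised up to isomorphism as a Dedekind-complete
-- totally ordered field.
record CompleteOrderedField : Set₁ where
  infix  4 _≈_ _≤_
  infixl 6 _+_
  infixl 7 _*_
  infix  8 -_
  infix  9 _⁻¹
  field
    Carrier           : Set
    _≈_ _≤_           : Rel Carrier 0ℓ
    _+_ _*_           : Carrier → Carrier → Carrier
    -_ _⁻¹            : Carrier → Carrier
    0# 1#             : Carrier
    isCommutativeRing : IsCommutativeRing _≈_ _+_ _*_ -_ 0# 1#
    0≉1               : ¬ (0# ≈ 1#)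
    -- The inverse is total; its value at 0# is unspecified.
    ⁻¹-cong           : ∀ {x y} → x ≈ y → x ⁻¹ ≈ y ⁻¹
    ⁻¹-inverseʳ       : ∀ {x} → ¬ (x ≈ 0#) → x * x ⁻¹ ≈ 1#
    isTotalOrder      : IsTotalOrder _≈_ _≤_
    +-monoˡ-≤         : ∀ {x y} z → x ≤ y → x + z ≤ y + z
    *-nonNegative     : ∀ {x y} → 0# ≤ x → 0# ≤ y → 0# ≤ x * y

  UpperBound : Pred Carrier 0ℓ → Pred Carrier 0ℓ
  UpperBound S b = ∀ x → S x → x ≤ b

  field
    supremum : ∀ (S : Pred Carrier 0ℓ) → ∃ S → ∃ (UpperBound S) →
               ∃[ s ] UpperBound S s × (∀ b → UpperBound S b → s ≤ b)

  commutativeRing : CommutativeRing 0ℓ 0ℓ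
  commutativeRing = record { isCommutativeRing = isCommutativeRing }

  open IsTotalOrder isTotalOrder public using (total)
  open ToStrict _≈_ _≤_ public using (_<_)

-- Excluded middle makes this ordinary classical analysis: it decides the
-- mapper's test hⱼ(t) ≤ threshold and makes `lim` a total function.
module Classical (em : ExcludedMiddle 0ℓ) (ℝ : CompleteOrderedField) where

  open CompleteOrderedField ℝ
  private module R = CommutativeRing commutativeRing

  open RawMonoidOps R.+-rawMonoid public using (sum)
  open RawMonoidOps R.*-rawMonoid public renaming (sum to product) using ()

  infixl 6 _-_
  infixl 7 _/_

  _-_ _/_ : Carrier → Carrier → Carrier
  x - y = x + - y
  x / y = x * y ⁻¹

  fromℕ : ℕ → Carrier
  fromℕ n = RawMonoidOps._×_ R.+-rawMonoid n 1#

  ∣_∣ : Carrier → Carrier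
  ∣ x ∣ with total 0# x
  ... | inj₁ _ = x
  ... | inj₂ _ = - x

  infix 4 _⟶_ _=O_

  _⟶_ : (ℕ → Carrier) → Carrier → Set
  s ⟶ l = ∀ δ → 0# < δ → ∃[ M ] (∀ n → M ℕ.≤ n → ∣ s n - l ∣ ≤ δ)

  -- The value 0# for divergent sequences is a convention.
  lim : (ℕ → Carrier) → Carrier
  lim s with em {∃ (s ⟶_)}
  ... | yes (l , _) = l
  ... | no _        = 0#

  partialSum : (ℕ → Carrier) → ℕ → Carrier
  partialSum a n = sum {n} (λ i → a (toℕ i))

  -- log x = ∫₁ˣ dt/t, as the limit of the left Riemann sums over n + 1 equal
  -- subintervals; meaningful for 0 < x.
  log : Carrier → Carrier
  log x = lim riemannSum
    where
    riemannSum : ℕ → Carrier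
    riemannSum n = partialSum (λ i → Δ / (1# + fromℕ i * Δ)) (ℕ.suc n)
      where
      Δ : Carrier
      Δ = (x - 1#) / fromℕ (ℕ.suc n)

  -- The bound holds with one constant on the whole parameter type, not just
  -- eventually.
  _=O_ : ∀ {a} {A : Set a} → (A → Carrier) → (A → Carrier) → Set a
  f =O g = ∃[ C ] 0# < C × (∀ x → ∣ f x ∣ ≤ C * ∣ g x ∣)

  record ProbabilitySpace : Set₂ where
    field
      Ω : Set

    Event : Set₁
    Event = Pred Ω 0ℓ

    field
      Measurable   : Pred Event (lsuc 0ℓ)
      U-measurable : Measurable U
      ∁-measurable : ∀ {A} → Measurable A → Measurable (∁ A)
      ⋃-measurable : (A : ℕ → Event) → (∀ n → Measurable (A n)) →
                     Measurable (⋃ ℕ A)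
      ≐-measurable : ∀ {A B} → A ≐ B → Measurable A → Measurable B

      -- Defined on all predicates, but constrained only on measurable ones.
      P             : Event → Carrier
      P-cong        : ∀ {A B} → Measurable A → A ≐ B → P A ≈ P B
      P-nonNegative : ∀ {A} → Measurable A → 0# ≤ P A
      P-U           : P U ≈ 1#
      P-⋃           : (A : ℕ → Event) → (∀ n → Measurable (A n)) →
                      (∀ m n → m ≢ n → A m ⊥ A n) →
                      partialSum (λ n → P (A n)) ⟶ P (⋃ ℕ A)

  data Borel : Pred Carrier 0ℓ → Set₁ where
    ray        : ∀ a → Borel (_≤ a)
    complement : ∀ {B} → Borel B → Borel (∁ B)
    union      : (B : ℕ → Pred Carrier 0ℓ) → (∀ n → Borel (B n)) →
                 Borel (⋃ ℕ B)
    resp       : ∀ {A B} → A ≐ B → Borel A → Borel B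

  module _ (space : ProbabilitySpace) where
    open ProbabilitySpace space

    RandomVariable : (Ω → Carrier) → Set₁
    RandomVariable X = ∀ {B} → Borel B → Measurable (X ⊢ B)

    -- Being a distribution function, x ↦ P(X ≤ x) is then 0 to the left of
    -- [0,1] and 1 to the right of it.
    Uniform[0,1] : (Ω → Carrier) → Set
    Uniform[0,1] X = ∀ x → 0# ≤ x → x ≤ 1# → P (X ⊢ (_≤ x)) ≈ x

    -- Mutual independence of a finite doubly indexed family; subfamilies are
    -- covered by taking the remaining Borel sets to be everything.
    Independent : ∀ {m n} → (Fin m → Fin n → Ω → Carrier) → Set₁
    Independent {m} {n} X =
      (B : Fin m → Fin n → Pred Carrier 0ℓ) → (∀ i j → Borel (B i j)) →
      P (λ ω → ∀ i j → B i j (X i j ω)) ≈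
      product (λ i → product (λ j → P (X i j ⊢ B i j)))

    -- E[X] = Σₘ m · P(X = m).
    expectation : (Ω → ℕ) → Carrier
    expectation X = lim (partialSum (λ m → fromℕ m * P (λ ω → X ω ≡ m)))

  c : Carrier
  c = fromℕ 3

  -- A corpus of N documents, each the set of dictionary words it contains,
  -- with random hash functions h j : Fin N → [0,1] on document identifiers.
  record Setting : Set₂ where
    field
      N D k         : ℕ
      D-nonZero     : NonZero D
      k-nonZero     : NonZero k
      t             : Fin N → Subset D
      space         : ProbabilitySpace

    open ProbabilitySpace space public using (Ω)

    field
      h             : Fin k → Fin N → Ω → Carrier
      h-measurable  : ∀ j i → RandomVariable space (h j i)
      h-uniform     : ∀ j i → Uniform[0,1] space (h j i)
      h-independent : Independent space h

    # : Fin D → ℕ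
    # w = length (filter (λ i → w ∈? t i) (allFin N))

    Dk : Carrier
    Dk = fromℕ D * fromℕ k

    threshold : Fin D → Carrier
    threshold w = (c * log Dk) / fromℕ (# w)

    minHashSampleMap : Ω → Fin N → List ((Fin D × Fin k) × Carrier)
    minHashSampleMap ω i =
      map (λ (w , j) → (w , j) , h j i ω)
        (filter (λ (w , j) → (w ∈? t i) ×-dec em {h j i ω ≤ threshold w})
          (cartesianProduct (allFin D) (allFin k)))

    shuffleSize : Ω → ℕ
    shuffleSize ω = length (concatMap (minHashSampleMap ω) (allFin N))

    expectedShuffleSize : Carrier
    expectedShuffleSize = expectation space shuffleSize

  record Setting-1/ε : Set₂ where
    field
      setting : Setting
      ε       : Carrier
      0<ε     : 0# < ε
      ε≤1     : ε ≤ 1#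

    open Setting setting public

    field
      k≈1/ε   : fromℕ k ≈ 1# / ε

    D/ε : Carrier
    D/ε = fromℕ D / ε

{-# OPTIONS --safe #-}
module Submission where

-- Linearity of expectation: with threshold τ = c log(Dk) / #(w), each of the
-- #(w) documents containing w emits the pair (w, j) with probability at most τ,
-- so each of the Dk pairs contributes at most c log(Dk).  Of the logarithm only
-- log x ≥ 0 for x ≥ 1 and its invariance under ≈ matter.
--
-- The expectation is a limit of the sums Σ_{m<n} m · P(X = m).  Each of these is
-- bounded by the sum of the emission probabilities, so neither convergence nor
-- boundedness of X has to be discussed.

open import Defs
open import Level using (0ℓ)
open import Axiom.ExcludedMiddle using (ExcludedMiddle)
open import Data.Product.Base using (_×_)

open import Algebra.Bundles using (CommutativeRing)
import Algebra.Properties.AbelianGroup as AbelianGroupProperties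
import Algebra.Properties.CommutativeMonoid.Sum as SumProperties
import Algebra.Properties.CommutativeSemigroup as CommutativeSemigroupProperties
import Algebra.Properties.Ring as RingProperties
import Algebra.Properties.Semiring.Mult as MultProperties
open import Data.Bool.Base as Bool using (if_then_else_)
open import Data.Empty using (⊥-elim)
open import Data.Fin.Base using (Fin; toℕ)
open import Data.Fin.Subset using (_∈_)
open import Data.Fin.Subset.Properties using (_∈?_)
open import Data.List.Base
  using (List; []; _∷_; _++_; allFin; cartesianProduct; concatMap; filter;
         foldr; length; map)
open import Data.List.Properties
  using (filter-++; filter-accept; filter-reject; length-++; length-map;
         length-tabulate)
open import Data.List.Membership.Propositional.Properties
  using (∈-allFin; ∈-filter⁺; ∈-length)
open import Data.Nat.Base as ℕ using (ℕ; zero; suc; NonZero)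
import Data.Nat.Properties as ℕ
open import Data.Product.Base using (_,_; proj₁; proj₂; ∃)
open import Data.Sum.Base using (inj₁; inj₂)
open import Function.Base using (_∘_; id)
open import Relation.Binary.Bundles using (TotalOrder)
open import Relation.Binary.PropositionalEquality
  using (_≡_; refl; cong; cong₂; module ≡-Reasoning)
  renaming (sym to ≡-sym; trans to ≡-trans)
import Relation.Binary.Reasoning.PartialOrder as PartialOrderReasoning
open import Relation.Nullary using (¬_; yes; no; does)
open import Relation.Nullary.Decidable using (_×-dec_)
open import Relation.Unary using (Pred; Decidable; U; ∁; ∅; ⋃; _≐_; _⊥_; _∩_; _∪_)

-- Lengths of filtered and product lists.

module _ {I J K : Set} where

  -- `map` preserves length and `filter` distributes over `++`. This turns the output of a mapper,
  -- produced row by row, into a single filter over all pairs, so that its size becomes a count of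
  -- events.
  length-concatMap-filter : ∀ {Q : Pred (I × J) 0ℓ} (Q? : Decidable Q) (g : I → J → K) is js →
    length (concatMap (λ i → map (g i) (filter (λ j → Q? (i , j)) js)) is) ≡
    length (filter Q? (cartesianProduct is js))
  length-concatMap-filter Q? g []       js = refl
  length-concatMap-filter Q? g (i ∷ is) js = begin
    length (row ++ concatMap (λ i → map (g i) (filter (λ j → Q? (i , j)) js)) is)
      ≡⟨ length-++ row ⟩
    length row ℕ.+ length (concatMap (λ i → map (g i) (filter (λ j → Q? (i , j)) js)) is)
      ≡⟨ cong₂ ℕ._+_ (≡-trans (length-map (g i) (filter (λ j → Q? (i , j)) js)) (length-row js))
                    (length-concatMap-filter Q? g is js) ⟩
    length (filter Q? (map (i ,_) js)) ℕ.+ length (filter Q? (cartesianProduct is js))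
      ≡⟨ length-++ (filter Q? (map (i ,_) js)) ⟨
    length (filter Q? (map (i ,_) js) ++ filter Q? (cartesianProduct is js))
      ≡⟨ cong length (filter-++ Q? (map (i ,_) js) _) ⟨
    length (filter Q? (map (i ,_) js ++ cartesianProduct is js))
      ∎
    where
    open ≡-Reasoning

    row : List K
    row = map (g i) (filter (λ j → Q? (i , j)) js)

    length-row : ∀ js → length (filter (λ j → Q? (i , j)) js) ≡ length (filter Q? (map (i ,_) js))
    length-row []       = refl
    length-row (j ∷ js) with does (Q? (i , j))
    ... | Bool.false = length-row js
    ... | Bool.true  = cong suc (length-row js)

length-cartesianProduct : ∀ {I J : Set} (is : List I) (js : List J) →
                          length (cartesianProduct is js) ≡ length is ℕ.* length js
length-cartesianProduct []       js = refl
length-cartesianProduct (i ∷ is) js = ≡-trans (length-++ (map (i ,_) js))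
  (cong₂ ℕ._+_ (length-map (i ,_) js) (length-cartesianProduct is js))

-- Arithmetic in the ordered field.

module OrderedField (ℝ : CompleteOrderedField) where

  open CompleteOrderedField ℝ
  private
    module R = CommutativeRing commutativeRing
    open R using (_-_)
  open R public
    using (sym; trans; +-cong; +-congˡ; +-congʳ; *-cong; *-congˡ; *-congʳ;
           +-comm; +-assoc; *-comm; *-assoc; +-identityˡ; +-identityʳ;
           *-identityˡ; *-identityʳ; zeroˡ; zeroʳ; distribˡ; distribʳ;
           -‿cong; -‿inverseʳ)
    renaming (refl to ≈-refl; reflexive to ≈-reflexive)
  open AbelianGroupProperties R.+-abelianGroup public
    using (⁻¹-anti-homo‿-; ⁻¹-involutive; //-rightDividesˡ; //-rightDividesʳ;
           x∙y⁻¹≈ε⇒x≈y)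
    renaming (ε⁻¹≈ε to -0≈0)
  open RingProperties R.ring public
    using (-‿distribʳ-*; -1*x≈-x; x[y-z]≈xy-xz)
  open CommutativeSemigroupProperties R.+-commutativeSemigroup public
    using (interchange)
  open MultProperties R.semiring public
    using (×1-homo-*; ×-assoc-*)
    renaming (_×_ to _·_)

  totalOrder : TotalOrder 0ℓ 0ℓ 0ℓ
  totalOrder = record { isTotalOrder = isTotalOrder }

  open TotalOrder totalOrder public
    using (antisym)
    renaming (refl to ≤-refl; reflexive to ≤-reflexive; trans to ≤-trans)
  open PartialOrderReasoning (TotalOrder.poset totalOrder) public

  +-monoʳ-≤ : ∀ {x y} z → x ≤ y → z + x ≤ z + y
  +-monoʳ-≤ {x} {y} z x≤y = begin
    z + x  ≈⟨ +-comm z x ⟩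
    x + z  ≤⟨ +-monoˡ-≤ z x≤y ⟩
    y + z  ≈⟨ +-comm y z ⟩
    z + y  ∎

  +-mono-≤ : ∀ {x y u v} → x ≤ y → u ≤ v → x + u ≤ y + v
  +-mono-≤ {y = y} {u = u} x≤y u≤v = ≤-trans (+-monoˡ-≤ u x≤y) (+-monoʳ-≤ y u≤v)

  +-nonNegative : ∀ {x y} → 0# ≤ x → 0# ≤ y → 0# ≤ x + y
  +-nonNegative 0≤x 0≤y = ≤-trans (≤-reflexive (sym (+-identityʳ 0#))) (+-mono-≤ 0≤x 0≤y)

  x≤x+y : ∀ {x y} → 0# ≤ y → x ≤ x + y
  x≤x+y {x} {y} 0≤y = begin
    x       ≈⟨ +-identityʳ x ⟨
    x + 0#  ≤⟨ +-monoʳ-≤ x 0≤y ⟩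
    x + y   ∎

  +-cancelʳ-≤ : ∀ {x y} z → x + z ≤ y + z → x ≤ y
  +-cancelʳ-≤ {x} {y} z x+z≤y+z = begin
    x              ≈⟨ //-rightDividesʳ z x ⟨
    (x + z) + - z  ≤⟨ +-monoˡ-≤ (- z) x+z≤y+z ⟩
    (y + z) + - z  ≈⟨ //-rightDividesʳ z y ⟩
    y              ∎

  x≤y⇒0≤y-x : ∀ {x y} → x ≤ y → 0# ≤ y - x
  x≤y⇒0≤y-x {x} {y} x≤y = begin
    0#       ≈⟨ -‿inverseʳ x ⟨
    x - x    ≤⟨ +-monoˡ-≤ (- x) x≤y ⟩
    y - x    ∎

  x-y≤z⇒x≤z+y : ∀ {x y z} → x - y ≤ z → x ≤ z + y
  x-y≤z⇒x≤z+y {x} {y} {z} x-y≤z = begin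
    x            ≈⟨ //-rightDividesˡ y x ⟨
    (x - y) + y  ≤⟨ +-monoˡ-≤ y x-y≤z ⟩
    z + y        ∎

  0≤y-x⇒x≤y : ∀ {x y} → 0# ≤ y - x → x ≤ y
  0≤y-x⇒x≤y {x} {y} 0≤y-x = begin
    x            ≈⟨ +-identityˡ x ⟨
    0# + x       ≤⟨ +-monoˡ-≤ x 0≤y-x ⟩
    (y - x) + x  ≈⟨ //-rightDividesˡ x y ⟩
    y            ∎

  x≤0⇒0≤-x : ∀ {x} → x ≤ 0# → 0# ≤ - x
  x≤0⇒0≤-x {x} x≤0 = ≤-trans (x≤y⇒0≤y-x x≤0) (≤-reflexive (+-identityˡ (- x)))

  *-monoʳ-≤ : ∀ {x y z} → 0# ≤ z → x ≤ y → z * x ≤ z * y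
  *-monoʳ-≤ {x} {y} {z} 0≤z x≤y = 0≤y-x⇒x≤y (≤-trans
    (*-nonNegative 0≤z (x≤y⇒0≤y-x x≤y)) (≤-reflexive (x[y-z]≈xy-xz z y x)))

  -- If 1 ≤ 0, then -1 is nonnegative, and hence so is its square, which is 1.
  0≤1 : 0# ≤ 1#
  0≤1 with total 0# 1#
  ... | inj₁ 0≤1 = 0≤1
  ... | inj₂ 1≤0 = begin
    0#             ≤⟨ *-nonNegative 0≤-1 0≤-1 ⟩
    - 1# * - 1#    ≈⟨ -1*x≈-x (- 1#) ⟩
    - - 1#         ≈⟨ ⁻¹-involutive 1# ⟩
    1#             ∎
    where
    0≤-1 : 0# ≤ - 1#
    0≤-1 = x≤0⇒0≤-x 1≤0

  -- Every denominator whose inverse is computed with or given a sign below is at least 1: a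
  -- positive numeral, or some 1 + iΔ in a Riemann sum.
  1≤x⇒x≉0 : ∀ {x} → 1# ≤ x → ¬ (x ≈ 0#)
  1≤x⇒x≉0 1≤x x≈0 = 0≉1 (antisym 0≤1 (≤-trans 1≤x (≤-reflexive x≈0)))

  -- A nonpositive inverse would make `x * - x ⁻¹`, which equals -1, a product of nonnegative
  -- factors.
  ⁻¹-nonNegative : ∀ {x} → 1# ≤ x → 0# ≤ x ⁻¹
  ⁻¹-nonNegative {x} 1≤x with total 0# (x ⁻¹)
  ... | inj₁ 0≤x⁻¹ = 0≤x⁻¹
  ... | inj₂ x⁻¹≤0 = ⊥-elim (1≤x⇒x≉0 ≤-refl (antisym 1≤0 0≤1))
    where
    1≤0 : 1# ≤ 0#
    1≤0 = 0≤y-x⇒x≤y (begin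
      0#            ≤⟨ *-nonNegative (≤-trans 0≤1 1≤x) (x≤0⇒0≤-x x⁻¹≤0) ⟩
      x * - x ⁻¹    ≈⟨ -‿distribʳ-* x (x ⁻¹) ⟨
      - (x * x ⁻¹)  ≈⟨ -‿cong (⁻¹-inverseʳ (1≤x⇒x≉0 1≤x)) ⟩
      - 1#          ≈⟨ +-identityˡ (- 1#) ⟨
      0# - 1#       ∎)

  0≤n·1 : ∀ n → 0# ≤ n · 1#
  0≤n·1 zero    = ≤-refl
  0≤n·1 (suc n) = +-nonNegative 0≤1 (0≤n·1 n)

  1≤[1+n]·1 : ∀ n → 1# ≤ suc n · 1#
  1≤[1+n]·1 n = x≤x+y (0≤n·1 n)

  n·1*x≈n·x : ∀ n x → (n · 1#) * x ≈ n · x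
  n·1*x≈n·x n x = trans (×-assoc-* n 1# x) (MultProperties.×-congʳ R.semiring n (*-identityˡ x))

  -- Finite sums over lists.

  sumOver : ∀ {I : Set} → (I → Carrier) → List I → Carrier
  sumOver f = foldr (λ i s → f i + s) 0#

  module _ {I : Set} where

    sumOver-mono : ∀ {f g : I → Carrier} → (∀ i → f i ≤ g i) →
                   ∀ is → sumOver f is ≤ sumOver g is
    sumOver-mono f≤g []       = ≤-refl
    sumOver-mono f≤g (i ∷ is) = +-mono-≤ (f≤g i) (sumOver-mono f≤g is)

    sumOver-cong : ∀ {f g : I → Carrier} → (∀ i → f i ≈ g i) →
                   ∀ is → sumOver f is ≈ sumOver g is
    sumOver-cong f≈g []       = ≈-refl
    sumOver-cong f≈g (i ∷ is) = +-cong (f≈g i) (sumOver-cong f≈g is)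

    sumOver-distrib-+ : ∀ (f g : I → Carrier) is →
                        sumOver (λ i → f i + g i) is ≈ sumOver f is + sumOver g is
    sumOver-distrib-+ f g []       = sym (+-identityʳ 0#)
    sumOver-distrib-+ f g (i ∷ is) =
      trans (+-congˡ (sumOver-distrib-+ f g is)) (interchange _ _ _ _)

    sumOver-const : ∀ x (is : List I) → sumOver (λ _ → x) is ≈ (length is · 1#) * x
    sumOver-const x is = trans (≈-reflexive (copies is)) (sym (n·1*x≈n·x (length is) x))
      where
      copies : ∀ is → sumOver (λ (_ : I) → x) is ≡ length is · x
      copies []       = refl
      copies (_ ∷ is) = cong (x +_) (copies is)

    -- With `Q` the documents containing a word `w`, the factor on the right is `# w`, which later
    -- cancels the denominator of the threshold.
    sumOver-indicator : ∀ {Q : Pred I 0ℓ} (Q? : Decidable Q) x is →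
      sumOver (λ i → if does (Q? i) then x else 0#) is ≈ (length (filter Q? is) · 1#) * x
    sumOver-indicator Q? x is = trans (copies is) (sym (n·1*x≈n·x (length (filter Q? is)) x))
      where
      copies : ∀ is → sumOver (λ i → if does (Q? i) then x else 0#) is ≈ length (filter Q? is) · x
      copies []       = ≈-refl
      copies (i ∷ is) with Q? i
      ... | yes _ = +-congˡ (copies is)
      ... | no  _ = trans (+-identityˡ _) (copies is)

    sumOver-++ : ∀ (f : I → Carrier) is js → sumOver f (is ++ js) ≈ sumOver f is + sumOver f js
    sumOver-++ f []       js = sym (+-identityˡ _)
    sumOver-++ f (i ∷ is) js = trans (+-congˡ (sumOver-++ f is js)) (sym (+-assoc _ _ _))

  sumOver-map : ∀ {I J : Set} (f : J → Carrier) (g : I → J) is →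
                sumOver f (map g is) ≡ sumOver (f ∘ g) is
  sumOver-map f g []       = refl
  sumOver-map f g (i ∷ is) = cong (f (g i) +_) (sumOver-map f g is)

  module _ {I J : Set} where

    sumOver-cartesianProduct : ∀ (f : I × J → Carrier) is js →
      sumOver f (cartesianProduct is js) ≈ sumOver (λ i → sumOver (λ j → f (i , j)) js) is
    sumOver-cartesianProduct f []       js = ≈-refl
    sumOver-cartesianProduct f (i ∷ is) js =
      trans (sumOver-++ f (map (i ,_) js) (cartesianProduct is js))
            (+-cong (≈-reflexive (sumOver-map f (i ,_) js)) (sumOver-cartesianProduct f is js))

    sumOver-comm : ∀ (f : I → J → Carrier) is js →
      sumOver (λ i → sumOver (f i) js) is ≈ sumOver (λ j → sumOver (λ i → f i j) is) js
    sumOver-comm f []       js = sym (trans (sumOver-const 0# js) (zeroʳ _))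
    sumOver-comm f (i ∷ is) js =
      trans (+-congˡ (sumOver-comm f is js)) (sym (sumOver-distrib-+ (f i) _ js))

-- Absolute values, the O-relation and limits.

module Analysis (em : ExcludedMiddle 0ℓ) (ℝ : CompleteOrderedField) where

  open CompleteOrderedField ℝ
  open Classical em ℝ
  open OrderedField ℝ

  private
    variable
      s u : ℕ → Carrier
      l l′ x y : Carrier

  x≤∣x∣ : x ≤ ∣ x ∣
  x≤∣x∣ {x} with total 0# x
  ... | inj₁ _   = ≤-refl
  ... | inj₂ x≤0 = ≤-trans x≤0 (x≤0⇒0≤-x x≤0)

  -x≤∣x∣ : - x ≤ ∣ x ∣
  -x≤∣x∣ {x} with total 0# x
  ... | inj₁ 0≤x = ≤-trans (0≤y-x⇒x≤y (≤-trans 0≤x (≤-reflexive 0≈))) 0≤x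
    where
    0≈ : x ≈ 0# - - x
    0≈ = trans (sym (⁻¹-involutive x)) (sym (+-identityˡ _))
  ... | inj₂ _   = ≤-refl

  0≤x⇒∣x∣≤x : 0# ≤ x → ∣ x ∣ ≤ x
  0≤x⇒∣x∣≤x {x} 0≤x with total 0# x
  ... | inj₁ _   = ≤-refl
  ... | inj₂ x≤0 = ≤-trans (≤-reflexive (trans (-‿cong x≈0) -0≈0)) 0≤x
    where
    x≈0 : x ≈ 0#
    x≈0 = antisym x≤0 0≤x

  x≈0⇒∣x∣≤0 : x ≈ 0# → ∣ x ∣ ≤ 0#
  x≈0⇒∣x∣≤0 x≈0 = ≤-trans (0≤x⇒∣x∣≤x (≤-reflexive (sym x≈0))) (≤-reflexive x≈0)

  -- Reduces an O-claim to a one-sided pointwise bound: `∣ f z ∣` is at most `f z`, and replacing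
  -- `g z` by its absolute value only enlarges the right-hand side, since `C` is nonnegative.
  =O-nonNegative : ∀ {a} {A : Set a} {f g : A → Carrier} (C : Carrier) → 0# < C →
                   (∀ z → 0# ≤ f z) → (∀ z → f z ≤ C * g z) → f =O g
  =O-nonNegative C 0<C 0≤f f≤Cg = C , 0<C , λ z →
    ≤-trans (0≤x⇒∣x∣≤x (0≤f z)) (≤-trans (f≤Cg z) (*-monoʳ-≤ (proj₁ 0<C) x≤∣x∣))

  -- Apply the hypothesis to δ = (x − y) / 3: it gives 3δ ≤ 2δ.
  ≤-by-approximation : (∀ δ → 0# < δ → x ≤ δ + δ + y) → x ≤ y
  ≤-by-approximation {x} {y} x≤2δ+y with total x y
  ... | inj₁ x≤y = x≤y
  ... | inj₂ y≤x with em {x ≈ y}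
  ... | yes x≈y = ≤-reflexive x≈y
  ... | no  x≉y = ⊥-elim (δ≉0 (antisym 0≤δ δ≤0))
    where
    δ : Carrier
    δ = (x - y) / fromℕ 3

    1≤3 : 1# ≤ fromℕ 3
    1≤3 = 1≤[1+n]·1 2

    0≤δ : 0# ≤ δ
    0≤δ = *-nonNegative (x≤y⇒0≤y-x y≤x) (⁻¹-nonNegative 1≤3)

    3δ≈x-y : δ + (δ + δ) ≈ x - y
    3δ≈x-y = begin-equality
      δ + (δ + δ)                       ≈⟨ +-congˡ (+-congˡ (+-identityʳ δ)) ⟨
      3 · δ                               ≈⟨ n·1*x≈n·x 3 δ ⟨
      fromℕ 3 * ((x - y) * fromℕ 3 ⁻¹)     ≈⟨ *-comm _ _ ⟩
      (x - y) * fromℕ 3 ⁻¹ * fromℕ 3       ≈⟨ *-assoc _ _ _ ⟩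
      (x - y) * (fromℕ 3 ⁻¹ * fromℕ 3)     ≈⟨ *-congˡ (*-comm _ _) ⟩
      (x - y) * (fromℕ 3 * fromℕ 3 ⁻¹)     ≈⟨ *-congˡ (⁻¹-inverseʳ (1≤x⇒x≉0 1≤3)) ⟩
      (x - y) * 1#                         ≈⟨ *-identityʳ _ ⟩
      x - y                                ∎

    δ≉0 : ¬ (0# ≈ δ)
    δ≉0 0≈δ = x≉y (x∙y⁻¹≈ε⇒x≈y x y (trans (sym 3δ≈x-y)
      (trans (+-cong (sym 0≈δ) (+-cong (sym 0≈δ) (sym 0≈δ)))
             (trans (+-identityˡ _) (+-identityˡ _)))))

    δ≤0 : δ ≤ 0#
    δ≤0 = +-cancelʳ-≤ (δ + δ) (+-cancelʳ-≤ y (begin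
      δ + (δ + δ) + y    ≈⟨ +-congʳ 3δ≈x-y ⟩
      (x - y) + y           ≈⟨ //-rightDividesˡ y x ⟩
      x                     ≤⟨ x≤2δ+y δ (0≤δ , δ≉0) ⟩
      δ + δ + y           ≈⟨ +-congʳ (+-identityˡ _) ⟨
      0# + (δ + δ) + y    ∎))

  -- At an index beyond `M` and both moduli of convergence, `l` ≤ `s n` + δ ≤ `u n` + δ ≤ `l′` + 2δ.
  -- Indices have the form `M ℕ.+ n` so that for `M` = 2 the first two terms of a partial sum split
  -- off by computation.
  ⟶-mono : ∀ M → (∀ n → s (M ℕ.+ n) ≤ u (M ℕ.+ n)) → s ⟶ l → u ⟶ l′ → l ≤ l′
  ⟶-mono {s} {u} {l} {l′} M s≤u s⟶l u⟶l′ = ≤-by-approximation λ δ 0<δ →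
    let M₁ , s-near = s⟶l δ 0<δ
        M₂ , u-near = u⟶l′ δ 0<δ
        m = M₁ ℕ.+ M₂
        n = M ℕ.+ m
        M₁≤n : M₁ ℕ.≤ n
        M₁≤n = ℕ.≤-trans (ℕ.m≤m+n M₁ M₂) (ℕ.m≤n+m m M)
        M₂≤n : M₂ ℕ.≤ n
        M₂≤n = ℕ.≤-trans (ℕ.m≤n+m M₂ M₁) (ℕ.m≤n+m m M)
    in begin
    l               ≤⟨ x-y≤z⇒x≤z+y (≤-trans (≤-reflexive (sym (⁻¹-anti-homo‿- (s n) l)))
                                            (≤-trans -x≤∣x∣ (s-near n M₁≤n))) ⟩
    δ + s n         ≤⟨ +-monoʳ-≤ δ (s≤u m) ⟩
    δ + u n         ≤⟨ +-monoʳ-≤ δ (x-y≤z⇒x≤z+y (≤-trans x≤∣x∣ (u-near n M₂≤n))) ⟩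
    δ + (δ + l′)    ≈⟨ +-assoc δ δ l′ ⟨
    δ + δ + l′      ∎

  ⟶-const : ∀ x → (λ _ → x) ⟶ x
  ⟶-const x δ 0<δ = 0 , λ _ _ → ≤-trans (x≈0⇒∣x∣≤0 (-‿inverseʳ x)) (proj₁ 0<δ)

  -- `∣_∣` branches on `total`, whose answers at equal arguments may differ. Whichever sign is
  -- chosen for `u n - l`, the result equals plus or minus `s n - l` and is therefore at most
  -- `∣ s n - l ∣`.
  ⟶-resp-≈ : (∀ n → s n ≈ u n) → s ⟶ l → u ⟶ l
  ⟶-resp-≈ {s} {u} {l} s≈u s⟶l δ 0<δ with s⟶l δ 0<δ
  ... | M , near = M , λ n M≤n → ≤-trans (bound n) (near n M≤n)
    where
    bound : ∀ n → ∣ u n - l ∣ ≤ ∣ s n - l ∣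
    bound n with total 0# (u n - l)
    ... | inj₁ _ = ≤-trans (≤-reflexive (+-congʳ (sym (s≈u n)))) x≤∣x∣
    ... | inj₂ _ = ≤-trans (≤-reflexive (-‿cong (+-congʳ (sym (s≈u n))))) -x≤∣x∣

  -- Both sequences converge or both diverge. In the first case `em` may pick unrelated witnesses,
  -- and monotonicity in both directions identifies the limits; in the second both values are the
  -- conventional 0.
  lim-cong : (∀ n → s n ≈ u n) → lim s ≈ lim u
  lim-cong {s} {u} s≈u with em {∃ (s ⟶_)} | em {∃ (u ⟶_)}
  ... | yes (_ , s⟶l) | yes (_ , u⟶l′) =
    antisym (⟶-mono 0 (λ n → ≤-reflexive (s≈u n)) s⟶l u⟶l′)
            (⟶-mono 0 (λ n → ≤-reflexive (sym (s≈u n))) u⟶l′ s⟶l)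
  ... | yes (l , s⟶l) | no ¬u          = ⊥-elim (¬u (l , ⟶-resp-≈ s≈u s⟶l))
  ... | no ¬s         | yes (l , u⟶l)  = ⊥-elim (¬s (l , ⟶-resp-≈ (λ n → sym (s≈u n)) u⟶l))
  ... | no _          | no _           = ≈-refl

  lim-nonNegative : (∀ n → 0# ≤ s n) → 0# ≤ lim s
  lim-nonNegative {s} 0≤s with em {∃ (s ⟶_)}
  ... | yes (_ , s⟶l) = ⟶-mono 0 0≤s (⟶-const 0#) s⟶l
  ... | no _          = ≤-refl

  -- The assumption `0# ≤ x` covers divergence, where the limit takes the value 0.
  lim-≤ : 0# ≤ x → (∀ n → s n ≤ x) → lim s ≤ x
  lim-≤ {x} {s} 0≤x s≤x with em {∃ (s ⟶_)}
  ... | yes (_ , s⟶l) = ⟶-mono 0 s≤x s⟶l (⟶-const x)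
  ... | no _          = 0≤x

  -- Partial sums and the logarithm.

  private module ∑ = SumProperties (CommutativeRing.+-commutativeMonoid commutativeRing)

  module _ {a b : ℕ → Carrier} where

    partialSum-cong : (∀ n → a n ≈ b n) → ∀ n → partialSum a n ≈ partialSum b n
    partialSum-cong a≈b n = ∑.sum-cong-≋ {n} (λ i → a≈b (toℕ i))

    partialSum-distrib-+ : ∀ n → partialSum (λ m → a m + b m) n ≈ partialSum a n + partialSum b n
    partialSum-distrib-+ n = ∑.∑-distrib-+ {n} (a ∘ toℕ) (b ∘ toℕ)

  partialSum-nonNegative : ∀ {a} → (∀ n → 0# ≤ a n) → ∀ n → 0# ≤ partialSum a n
  partialSum-nonNegative         0≤a zero    = ≤-refl
  partialSum-nonNegative {a = a} 0≤a (suc n) =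
    +-nonNegative (0≤a 0) (partialSum-nonNegative {a = a ∘ suc} (0≤a ∘ suc) n)

  partialSum-zero : ∀ {a} → (∀ n → a n ≈ 0#) → ∀ n → partialSum a n ≈ 0#
  partialSum-zero {a} a≈0 n = trans (partialSum-cong {a} a≈0 n) (∑.sum-replicate-zero n)

  -- Convergence of the Riemann sums is irrelevant: in the divergent case log x
  -- is the conventional value 0.
  log-nonNegative : 1# ≤ x → 0# ≤ log x
  log-nonNegative {x} 1≤x = lim-nonNegative λ n →
    let Δ = (x - 1#) / fromℕ (suc n)
        0≤Δ : 0# ≤ Δ
        0≤Δ = *-nonNegative (x≤y⇒0≤y-x 1≤x) (⁻¹-nonNegative (1≤[1+n]·1 n))
    in partialSum-nonNegative {a = λ i → Δ / (1# + fromℕ i * Δ)}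
         (λ i → *-nonNegative 0≤Δ (⁻¹-nonNegative (x≤x+y (*-nonNegative (0≤n·1 i) 0≤Δ))))
         (suc n)

  log-cong : x ≈ y → log x ≈ log y
  log-cong {x} {y} x≈y = lim-cong λ n →
    let Δ : Carrier → Carrier
        Δ z = (z - 1#) / fromℕ (suc n)
        Δ-cong : Δ x ≈ Δ y
        Δ-cong = *-congʳ (+-congʳ x≈y)
    in partialSum-cong {λ i → Δ x / (1# + fromℕ i * Δ x)} {λ i → Δ y / (1# + fromℕ i * Δ y)}
         (λ i → *-cong Δ-cong (⁻¹-cong (+-congˡ (*-congˡ Δ-cong)))) (suc n)

-- Finite additivity and monotonicity of probability.

module Probability (em : ExcludedMiddle 0ℓ) (ℝ : CompleteOrderedField)
                   (space : Classical.ProbabilitySpace em ℝ) where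

  open CompleteOrderedField ℝ
  open Classical em ℝ
  open OrderedField ℝ
  open Analysis em ℝ
  open ProbabilitySpace space

  private
    variable
      A B : Event

  ∅-measurable : Measurable ∅
  ∅-measurable = ≐-measurable ((λ ¬U → ¬U _) , λ ()) (∁-measurable U-measurable)

  -- The axioms speak of countable unions only; a binary union is encoded as one by padding with
  -- `∅`.
  pair : Event → Event → ℕ → Event
  pair A B 0             = A
  pair A B 1             = B
  pair A B (suc (suc _)) = ∅

  pair-measurable : Measurable A → Measurable B → ∀ n → Measurable (pair A B n)
  pair-measurable A-meas B-meas 0             = A-meas
  pair-measurable A-meas B-meas 1             = B-meas
  pair-measurable A-meas B-meas (suc (suc _)) = ∅-measurable

  ⋃-pair : ⋃ ℕ (pair A B) ≐ (A ∪ B)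
  ⋃-pair = (λ { (0 , a) → inj₁ a ; (1 , b) → inj₂ b ; (suc (suc _) , ()) })
         , (λ { (inj₁ a) → 0 , a ; (inj₂ b) → 1 , b })

  ∪-measurable : Measurable A → Measurable B → Measurable (A ∪ B)
  ∪-measurable A-meas B-meas =
    ≐-measurable ⋃-pair (⋃-measurable _ (pair-measurable A-meas B-meas))

  ∩-measurable : Measurable A → Measurable B → Measurable (A ∩ B)
  ∩-measurable {A} {B} A-meas B-meas =
    ≐-measurable (deMorgan , λ { (a , b) (inj₁ ¬a) → ¬a a ; (a , b) (inj₂ ¬b) → ¬b b })
      (∁-measurable (∪-measurable (∁-measurable A-meas) (∁-measurable B-meas)))
    where
    deMorgan : ∀ {ω} → ¬ (∁ A ∪ ∁ B) ω → (A ∩ B) ω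
    deMorgan {ω} ¬¬ with em {A ω} | em {B ω}
    ... | yes a | yes b = a , b
    ... | no ¬a | _     = ⊥-elim (¬¬ (inj₁ ¬a))
    ... | _     | no ¬b = ⊥-elim (¬¬ (inj₂ ¬b))

  -- The constant sequence ∅, ∅, … gives P ∅ + P ∅ ≤ P ∅ in the limit.
  P-∅ : P ∅ ≈ 0#
  P-∅ = antisym (+-cancelʳ-≤ (P ∅) (≤-trans P∅+P∅≤P∅ (≤-reflexive (sym (+-identityˡ _))))) 0≤P∅
    where
    0≤P∅ : 0# ≤ P ∅
    0≤P∅ = P-nonNegative ∅-measurable

    ⋃∅ : P (⋃ ℕ (λ _ → ∅)) ≈ P ∅
    ⋃∅ = P-cong (⋃-measurable _ (λ _ → ∅-measurable)) ((λ ()) , λ ())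

    P∅+P∅≤P∅ : P ∅ + P ∅ ≤ P ∅
    P∅+P∅≤P∅ = ≤-trans
      (⟶-mono 2 (λ n → +-monoʳ-≤ _ (x≤x+y (partialSum-nonNegative (λ _ → 0≤P∅) n)))
        (⟶-const _) (P-⋃ (λ _ → ∅) (λ _ → ∅-measurable) (λ _ _ _ ())))
      (≤-reflexive ⋃∅)

  -- Since `∅` has probability 0, the partial sums for `pair A B` equal `P A + P B` from index 2 on,
  -- so their limit, given by countable additivity, has this value too.
  P-∪ : Measurable A → Measurable B → A ⊥ B → P (A ∪ B) ≈ P A + P B
  P-∪ {A} {B} A-meas B-meas A⊥B = begin-equality
    P (A ∪ B)           ≈⟨ P-cong (⋃-measurable _ meas) ⋃-pair ⟨
    P (⋃ ℕ (pair A B))  ≈⟨ antisym (⟶-mono 2 (λ n → ≤-reflexive (sums n)) limit (⟶-const _))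
                                   (⟶-mono 2 (λ n → ≤-reflexive (sym (sums n))) (⟶-const _) limit) ⟩
    P A + P B           ∎
    where
    meas : ∀ n → Measurable (pair A B n)
    meas = pair-measurable A-meas B-meas

    disjoint : ∀ m n → ¬ (m ≡ n) → pair A B m ⊥ pair A B n
    disjoint 0             0             0≢0 _       = 0≢0 refl
    disjoint 0             1             _           = A⊥B
    disjoint 1             0             _   (b , a) = A⊥B (a , b)
    disjoint 1             1             1≢1 _       = 1≢1 refl
    disjoint 0             (suc (suc _)) _   (_ , ())
    disjoint 1             (suc (suc _)) _   (_ , ())
    disjoint (suc (suc _)) _             _   (() , _)

    limit : partialSum (λ n → P (pair A B n)) ⟶ P (⋃ ℕ (pair A B))
    limit = P-⋃ (pair A B) meas disjoint

    sums : ∀ n → partialSum (λ m → P (pair A B m)) (2 ℕ.+ n) ≈ P A + P B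
    sums n = +-congˡ (trans (+-congˡ (partialSum-zero {λ _ → P ∅} (λ _ → P-∅) n)) (+-identityʳ _))

  P-split : Measurable A → Measurable B → P B ≈ P (B ∩ A) + P (B ∩ ∁ A)
  P-split {A} {B} A-meas B-meas = trans
    (P-cong B-meas (cases , λ { (inj₁ (b , _)) → b ; (inj₂ (b , _)) → b }))
    (P-∪ (∩-measurable B-meas A-meas) (∩-measurable B-meas (∁-measurable A-meas))
         (λ { ((_ , a) , (_ , ¬a)) → ¬a a }))
    where
    cases : ∀ {ω} → B ω → ((B ∩ A) ∪ (B ∩ ∁ A)) ω
    cases {ω} b with em {A ω}
    ... | yes a = inj₁ (b , a)
    ... | no ¬a = inj₂ (b , ¬a)

  P-∩-≤ : Measurable A → Measurable B → P (B ∩ A) ≤ P B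
  P-∩-≤ A-meas B-meas = ≤-trans
    (x≤x+y (P-nonNegative (∩-measurable B-meas (∁-measurable A-meas))))
    (≤-reflexive (sym (P-split A-meas B-meas)))

  P-U∩ : Measurable A → P (U ∩ A) ≈ P A
  P-U∩ A-meas = P-cong (∩-measurable U-measurable A-meas) (proj₂ , (_ ,_))

  P-≤-1 : Measurable A → P A ≤ 1#
  P-≤-1 A-meas = ≤-trans (≤-reflexive (sym (P-U∩ A-meas)))
    (≤-trans (P-∩-≤ A-meas U-measurable) (≤-reflexive P-U))

  -- By induction on `n` with `B` varying: the later events are disjoint from `A 0`, so they meet
  -- `B` only inside `B ∩ ∁ (A 0)`, and the two pieces of `B` add up to `P B`.
  ∑P-disjoint-≤ : (A : ℕ → Event) → (∀ n → Measurable (A n)) →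
                  (∀ m n → ¬ (m ≡ n) → A m ⊥ A n) → Measurable B →
                  ∀ n → partialSum (λ m → P (B ∩ A m)) n ≤ P B
  ∑P-disjoint-≤         A A-meas A⊥ B-meas zero    = P-nonNegative B-meas
  ∑P-disjoint-≤ {B = B} A A-meas A⊥ B-meas (suc n) = begin
    P (B ∩ A 0) + partialSum (λ m → P (B ∩ A (suc m))) n
      ≈⟨ +-congˡ (partialSum-cong {λ m → P (B ∩ A (suc m))} outsideA₀ n) ⟩
    P (B ∩ A 0) + partialSum (λ m → P ((B ∩ ∁ (A 0)) ∩ A (suc m))) n
      ≤⟨ +-monoʳ-≤ _ (∑P-disjoint-≤ (A ∘ suc) (A-meas ∘ suc)
                        (λ m n m≢n → A⊥ _ _ (m≢n ∘ ℕ.suc-injective))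
                        (∩-measurable B-meas (∁-measurable (A-meas 0))) n) ⟩
    P (B ∩ A 0) + P (B ∩ ∁ (A 0))
      ≈⟨ P-split (A-meas 0) B-meas ⟨
    P B ∎
    where
    outsideA₀ : ∀ m → P (B ∩ A (suc m)) ≈ P ((B ∩ ∁ (A 0)) ∩ A (suc m))
    outsideA₀ m = P-cong (∩-measurable B-meas (A-meas (suc m)))
      ( (λ (b , a) → (b , λ a₀ → A⊥ 0 (suc m) (λ ()) (a₀ , a)) , a)
      , (λ ((b , _) , a) → b , a) )

  -- The expected number of events that occur.

  module Count {I : Set} (A : I → Event) (A? : ∀ ω → Decidable (λ i → A i ω))
               (A-meas : ∀ i → Measurable (A i)) where

    count : List I → Ω → ℕ
    count is ω = length (filter (A? ω) is)

    count-yes : ∀ {i is ω} → A i ω → count (i ∷ is) ω ≡ suc (count is ω)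
    count-yes {ω = ω} a = cong length (filter-accept (A? ω) a)

    count-no : ∀ {i is ω} → ¬ A i ω → count (i ∷ is) ω ≡ count is ω
    count-no {ω = ω} ¬a = cong length (filter-reject (A? ω) ¬a)

    countIs : List I → ℕ → Event
    countIs is m ω = count is ω ≡ m

    yes-suc : ∀ i is m → (A i ∩ countIs (i ∷ is) (suc m)) ≐ (A i ∩ countIs is m)
    yes-suc i is m = (λ (a , e) → a , ℕ.suc-injective (≡-trans (≡-sym (count-yes a)) e))
                   , (λ (a , e) → a , ≡-trans (count-yes a) (cong suc e))

    no-same : ∀ i is m → (∁ (A i) ∩ countIs (i ∷ is) m) ≐ (∁ (A i) ∩ countIs is m)
    no-same i is m = (λ (¬a , e) → ¬a , ≡-trans (≡-sym (count-no ¬a)) e)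
                   , (λ (¬a , e) → ¬a , ≡-trans (count-no ¬a) e)

    -- Splits on whether the first event occurs. If it does, the tail must have count m - 1, which
    -- is impossible for m = 0; if not, the tail has the same count.
    countIs-measurable : ∀ is m → Measurable (countIs is m)
    countIs-measurable []       zero    = ≐-measurable ((λ _ → refl) , _) U-measurable
    countIs-measurable []       (suc m) = ≐-measurable ((λ ()) , λ ()) ∅-measurable
    countIs-measurable (i ∷ is) m       = ≐-measurable (proj₂∪ , split)
      (∪-measurable (hit m) (≐-measurable (proj₂ (no-same i is m) , proj₁ (no-same i is m))
        (∩-measurable (∁-measurable (A-meas i)) (countIs-measurable is m))))
      where
      hit : ∀ m → Measurable (A i ∩ countIs (i ∷ is) m)
      hit zero    = ≐-measurable ((λ ()) , impossible) ∅-measurable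
        where
        impossible : ∀ {ω} → (A i ∩ countIs (i ∷ is) 0) ω → ∅ ω
        impossible (a , e) with () ← ≡-trans (≡-sym (count-yes a)) e
      hit (suc m) = ≐-measurable (proj₂ (yes-suc i is m) , proj₁ (yes-suc i is m))
        (∩-measurable (A-meas i) (countIs-measurable is m))

      proj₂∪ : ∀ {ω} → ((A i ∩ countIs (i ∷ is) m) ∪ (∁ (A i) ∩ countIs (i ∷ is) m)) ω →
               countIs (i ∷ is) m ω
      proj₂∪ (inj₁ (_ , e)) = e
      proj₂∪ (inj₂ (_ , e)) = e

      split : ∀ {ω} → countIs (i ∷ is) m ω →
              ((A i ∩ countIs (i ∷ is) m) ∪ (∁ (A i) ∩ countIs (i ∷ is) m)) ω
      split {ω} e with em {A i ω}
      ... | yes a = inj₁ (a , e)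
      ... | no ¬a = inj₂ (¬a , e)

    -- Partial sums of the series for the expectation of the count times the indicator of `B`.
    meanOn : Event → List I → ℕ → Carrier
    meanOn B is = partialSum (λ m → fromℕ m * P (B ∩ countIs is m))

    -- The event B is what makes the induction work: it absorbs the splitting
    -- according to whether the first event of the list occurs.
    meanOn-≤ : ∀ is n → Measurable B → meanOn B is n ≤ sumOver (λ i → P (B ∩ A i)) is
    meanOn-≤ {B} []       n B-meas = ≤-reflexive (partialSum-zero terms n)
      where
      terms : ∀ m → fromℕ m * P (B ∩ countIs [] m) ≈ 0#
      terms zero    = zeroˡ _
      terms (suc m) = trans
        (*-congˡ (trans (sym (P-cong ∅-measurable ((λ ()) , λ ()))) P-∅)) (zeroʳ _)
    meanOn-≤ {B} (i ∷ is) n B-meas = begin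
      meanOn B (i ∷ is) n
        -- Outside `A i` the head adds nothing, so that half is again a mean over the tail, on a
        -- smaller event. The half inside `A i` is left to `hits`.
        ≈⟨ partialSum-cong splitTerm n ⟩
      partialSum (λ m → hitTerm m + fromℕ m * P (B∖A ∩ countIs is m)) n
        ≈⟨ partialSum-distrib-+ {hitTerm} {λ m → fromℕ m * P (B∖A ∩ countIs is m)} n ⟩
      partialSum hitTerm n + meanOn B∖A is n
        ≤⟨ +-mono-≤ (hits n) (meanOn-≤ is n B∖A-meas) ⟩
      P BA + sumOver (λ j → P (BA ∩ A j)) is + sumOver (λ j → P (B∖A ∩ A j)) is
        ≈⟨ +-assoc _ _ _ ⟩
      P BA + (sumOver (λ j → P (BA ∩ A j)) is + sumOver (λ j → P (B∖A ∩ A j)) is)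
        ≈⟨ +-congˡ (sumOver-distrib-+ _ _ is) ⟨
      P BA + sumOver (λ j → P (BA ∩ A j) + P (B∖A ∩ A j)) is
        ≈⟨ +-congˡ (sumOver-cong (λ j → splitBy (A-meas j)) is) ⟨
      P BA + sumOver (λ j → P (B ∩ A j)) is
        ∎
      where
      BA B∖A : Event
      BA  = B ∩ A i
      B∖A = B ∩ ∁ (A i)

      BA-meas : Measurable BA
      BA-meas = ∩-measurable B-meas (A-meas i)

      B∖A-meas : Measurable B∖A
      B∖A-meas = ∩-measurable B-meas (∁-measurable (A-meas i))

      hitTerm : ℕ → Carrier
      hitTerm m = fromℕ m * P (BA ∩ countIs (i ∷ is) m)

      splitBy : ∀ {E} → Measurable E → P (B ∩ E) ≈ P (BA ∩ E) + P (B∖A ∩ E)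
      splitBy E-meas = trans (P-split (A-meas i) (∩-measurable B-meas E-meas))
        (+-cong (P-cong (∩-measurable (∩-measurable B-meas E-meas) (A-meas i))
                        ((λ ((b , e) , a) → (b , a) , e) , (λ ((b , a) , e) → (b , e) , a)))
                (P-cong (∩-measurable (∩-measurable B-meas E-meas) (∁-measurable (A-meas i)))
                        ((λ ((b , e) , a) → (b , a) , e) , (λ ((b , a) , e) → (b , e) , a))))

      splitTerm : ∀ m → fromℕ m * P (B ∩ countIs (i ∷ is) m) ≈
                        hitTerm m + fromℕ m * P (B∖A ∩ countIs is m)
      splitTerm m = trans
        (*-congˡ (trans (splitBy (countIs-measurable (i ∷ is) m)) (+-congˡ
          (P-cong (∩-measurable B∖A-meas (countIs-measurable (i ∷ is) m))
            ( (λ ((b , ¬a) , e) → (b , ¬a) , proj₂ (proj₁ (no-same i is m) (¬a , e)))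
            , (λ ((b , ¬a) , e) → (b , ¬a) , proj₂ (proj₂ (no-same i is m) (¬a , e))))))))
        (distribˡ _ _ _)

      hitTerm-suc : ∀ m → hitTerm (suc m) ≈
                          P (BA ∩ countIs is m) + fromℕ m * P (BA ∩ countIs is m)
      hitTerm-suc m = trans
        (*-congˡ (P-cong (∩-measurable BA-meas (countIs-measurable (i ∷ is) (suc m)))
          ( (λ ((b , a) , e) → (b , a) , proj₂ (proj₁ (yes-suc i is m) (a , e)))
          , (λ ((b , a) , e) → (b , a) , proj₂ (proj₂ (yes-suc i is m) (a , e))))))
        (trans (distribʳ _ _ _) (+-congʳ (*-identityˡ _)))

      -- Inside `A i` the count exceeds that of the tail by one. The term at 0 vanishes, and (m +
      -- 1)p = p + mp splits the rest: the summands p belong to disjoint events and total at most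
      -- `P BA`, while the summands mp form a mean over the tail.
      hits : ∀ n → partialSum hitTerm n ≤ P BA + sumOver (λ j → P (BA ∩ A j)) is
      -- With no terms the mean is 0, so the induction hypothesis says that the sum over the tail is
      -- nonnegative.
      hits zero    = ≤-trans (P-nonNegative BA-meas) (x≤x+y (meanOn-≤ is 0 BA-meas))
      hits (suc n) = begin
        0# * P (BA ∩ countIs (i ∷ is) 0) + partialSum (hitTerm ∘ suc) n
          ≈⟨ +-congʳ (zeroˡ _) ⟩
        0# + partialSum (hitTerm ∘ suc) n
          ≈⟨ +-identityˡ _ ⟩
        partialSum (hitTerm ∘ suc) n
          ≈⟨ partialSum-cong hitTerm-suc n ⟩
        partialSum (λ m → P (BA ∩ countIs is m) + fromℕ m * P (BA ∩ countIs is m)) n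
          ≈⟨ partialSum-distrib-+ {λ m → P (BA ∩ countIs is m)}
                                 {λ m → fromℕ m * P (BA ∩ countIs is m)} n ⟩
        partialSum (λ m → P (BA ∩ countIs is m)) n + meanOn BA is n
          ≤⟨ +-mono-≤ (∑P-disjoint-≤ (countIs is) (countIs-measurable is)
                         (λ { _ _ m≢n (e , e′) → m≢n (≡-trans (≡-sym e) e′) }) BA-meas n)
                      (meanOn-≤ is n BA-meas) ⟩
        P BA + sumOver (λ j → P (BA ∩ A j)) is
          ∎

    -- The case `B` = `U` of `meanOn-≤`, bounding all partial sums at once. `X` is separate from
    -- `count` because the shuffle size, the length of a concatenation, is only pointwise equal to a
    -- count.
    expectation-≤ : ∀ is (X : Ω → ℕ) → (∀ ω → X ω ≡ count is ω) → ∀ {x} → 0# ≤ x →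
                    sumOver (P ∘ A) is ≤ x → expectation space X ≤ x
    expectation-≤ is X X≡count 0≤x ∑P≤x = lim-≤ 0≤x λ n → ≤-trans
      (≤-reflexive (partialSum-cong (λ m → *-congˡ {fromℕ m} (sym (P-cong
        (∩-measurable U-measurable (countIs-measurable is m))
        ((λ {ω} (_ , e) → ≡-trans (X≡count ω) e) ,
         (λ {ω} e → _ , ≡-trans (≡-sym (X≡count ω)) e))))) n))
      (≤-trans (meanOn-≤ is n U-measurable)
        (≤-trans (≤-reflexive (sumOver-cong (λ i → P-U∩ (A-meas i)) is)) ∑P≤x))

    expectation-nonNegative : ∀ is (X : Ω → ℕ) → (∀ ω → X ω ≡ count is ω) →
                              0# ≤ expectation space X
    expectation-nonNegative is X X≡count = lim-nonNegative λ n → partialSum-nonNegative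
      (λ m → *-nonNegative (0≤n·1 m) (P-nonNegative (≐-measurable
        ((λ {ω} e → ≡-trans (X≡count ω) e) , (λ {ω} e → ≡-trans (≡-sym (X≡count ω)) e))
        (countIs-measurable is m)))) n

-- Emission events of the mapper and their probabilities.

module MinHash (em : ExcludedMiddle 0ℓ) (ℝ : CompleteOrderedField)
               (S : Classical.Setting em ℝ) where

  open CompleteOrderedField ℝ
  open Classical em ℝ
  open OrderedField ℝ
  open Analysis em ℝ
  open Setting S
  open ProbabilitySpace space using (Event; Measurable; P; P-cong; ≐-measurable)
  open Probability em ℝ space

  Word×Hash : Set
  Word×Hash = Fin D × Fin k

  words×hashes : List Word×Hash
  words×hashes = cartesianProduct (allFin D) (allFin k)

  Emitted : Fin N × Word×Hash → Event
  Emitted (i , w , j) ω = w ∈ t i × h j i ω ≤ threshold w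

  emitted? : ∀ ω → Decidable (λ x → Emitted x ω)
  emitted? ω (i , w , j) = (w ∈? t i) ×-dec em {h j i ω ≤ threshold w}

  Below : Fin N → Word×Hash → Event
  Below i (w , j) ω = h j i ω ≤ threshold w

  below-measurable : ∀ i p → Measurable (Below i p)
  below-measurable i (w , j) = h-measurable j i (ray (threshold w))

  emitted-measurable : ∀ x → Measurable (Emitted x)
  emitted-measurable (i , w , j) with w ∈? t i
  ... | yes w∈t = ≐-measurable ((w∈t ,_) , proj₂) (below-measurable i (w , j))
  ... | no  w∉t = ≐-measurable ((λ ()) , λ (w∈t , _) → w∉t w∈t) ∅-measurable

  open Count Emitted emitted? emitted-measurable

  -- `D` and `k` are nonzero, so their product is a successor. This puts `Dk` in the range where the
  -- logarithm is known to be nonnegative.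
  1≤Dk : 1# ≤ Dk
  1≤Dk = ≤-trans (1≤[1+n]·1 (ℕ.pred (D ℕ.* k)))
    (≤-reflexive (trans (≈-reflexive (cong fromℕ (ℕ.suc-pred (D ℕ.* k) ⦃ nz ⦄))) (×1-homo-* D k)))
    where
    nz : NonZero (D ℕ.* k)
    nz = ℕ.m*n≢0 D k ⦃ D-nonZero ⦄ ⦃ k-nonZero ⦄

  0≤c*log : 0# ≤ c * log Dk
  0≤c*log = *-nonNegative (0≤n·1 3) (log-nonNegative 1≤Dk)

  -- Equality holds when some document contains `w`. Otherwise the threshold divides by 0 and has an
  -- unspecified value, but the factor `# w` makes the left-hand side 0.
  #*threshold≤ : ∀ w → fromℕ (# w) * threshold w ≤ c * log Dk
  #*threshold≤ w with # w
  ... | zero  = ≤-trans (≤-reflexive (zeroˡ _)) 0≤c*log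
  ... | suc n = ≤-reflexive (trans (*-comm _ _) (trans (*-assoc _ _ _)
    (trans (*-congˡ (trans (*-comm _ _) (⁻¹-inverseʳ (1≤x⇒x≉0 (1≤[1+n]·1 n))))) (*-identityʳ _))))

  -- The document `i` itself is counted by `# w`, so the denominator is a positive numeral.
  0≤threshold : ∀ {w i} → w ∈ t i → 0# ≤ threshold w
  0≤threshold {w} {i} w∈ti
    with # w | ∈-length (∈-filter⁺ (λ i → w ∈? t i) (∈-allFin i) w∈ti)
  ... | suc n | _ = *-nonNegative 0≤c*log (⁻¹-nonNegative (1≤[1+n]·1 n))

  -- Uniformity gives the exact probability when the threshold lies in [0,1]; a threshold above 1
  -- exceeds every probability.
  P-below-≤ : ∀ {w i} j → w ∈ t i → P (Below i (w , j)) ≤ threshold w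
  P-below-≤ {w} {i} j w∈ti with total (threshold w) 1#
  ... | inj₁ ≤1 = ≤-reflexive (h-uniform j i (threshold w) (0≤threshold w∈ti) ≤1)
  ... | inj₂ 1≤ = ≤-trans (P-≤-1 (below-measurable i (w , j))) 1≤

  -- An upper bound for the emission probability, written as an indicator of membership to fit
  -- `sumOver-indicator`.
  weight : Fin N × Word×Hash → Carrier
  weight (i , w , j) = if does (w ∈? t i) then threshold w else 0#

  P-emitted-≤ : ∀ x → P (Emitted x) ≤ weight x
  P-emitted-≤ x@(i , w , j) with w ∈? t i
  ... | yes w∈ti = ≤-trans
    (≤-reflexive (P-cong (emitted-measurable x) (proj₂ , (w∈ti ,_)))) (P-below-≤ j w∈ti)
  ... | no  w∉ti = ≤-reflexive (trans
    (P-cong (emitted-measurable x) ((λ (w∈ti , _) → w∉ti w∈ti) , λ ())) P-∅)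

  trials : List (Fin N × Word×Hash)
  trials = cartesianProduct (allFin N) words×hashes

  length-words×hashes : length words×hashes ≡ D ℕ.* k
  length-words×hashes = ≡-trans (length-cartesianProduct (allFin D) (allFin k))
    (cong₂ ℕ._*_ (length-tabulate {n = D} id) (length-tabulate {n = k} id))

  ∑weight-≤ : sumOver weight trials ≤ c * Dk * log Dk
  ∑weight-≤ = begin
    sumOver weight trials
      ≈⟨ sumOver-cartesianProduct weight (allFin N) words×hashes ⟩
    sumOver (λ i → sumOver (λ p → weight (i , p)) words×hashes) (allFin N)
      -- With the documents innermost, the word is fixed and the threshold is constant, so each
      -- inner sum is `# w` times the threshold.
      ≈⟨ sumOver-comm (λ i p → weight (i , p)) (allFin N) words×hashes ⟩
    sumOver (λ p → sumOver (λ i → weight (i , p)) (allFin N)) words×hashes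
      ≤⟨ sumOver-mono (λ (w , _) → ≤-trans
           (≤-reflexive (sumOver-indicator (λ i → w ∈? t i) (threshold w) (allFin N)))
           (#*threshold≤ w)) words×hashes ⟩
    sumOver (λ _ → c * log Dk) words×hashes
      ≈⟨ sumOver-const (c * log Dk) words×hashes ⟩
    fromℕ (length words×hashes) * (c * log Dk)
      ≈⟨ *-congʳ (trans (≈-reflexive (cong fromℕ length-words×hashes)) (×1-homo-* D k)) ⟩
    Dk * (c * log Dk)
      ≈⟨ *-assoc _ _ _ ⟨
    Dk * c * log Dk
      ≈⟨ *-congʳ (*-comm _ _) ⟩
    c * Dk * log Dk
      ∎

  0≤c*Dk*log : 0# ≤ c * Dk * log Dk
  0≤c*Dk*log = *-nonNegative (*-nonNegative (0≤n·1 3) (≤-trans 0≤1 1≤Dk)) (log-nonNegative 1≤Dk)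

  shuffleSize≡count : ∀ ω → shuffleSize ω ≡ count trials ω
  shuffleSize≡count ω = length-concatMap-filter (emitted? ω)
    (λ { i (w , j) → (w , j) , h j i ω }) (allFin N) words×hashes

  expectedShuffleSize-≤ : expectedShuffleSize ≤ c * Dk * log Dk
  expectedShuffleSize-≤ = expectation-≤ trials shuffleSize shuffleSize≡count 0≤c*Dk*log
    (≤-trans (sumOver-mono P-emitted-≤ trials) ∑weight-≤)

  expectedShuffleSize-nonNegative : 0# ≤ expectedShuffleSize
  expectedShuffleSize-nonNegative = expectation-nonNegative trials shuffleSize shuffleSize≡count

-- The explicit bound and its O-forms.

theorem6 : (em : ExcludedMiddle 0ℓ) (ℝ : CompleteOrderedField) →
    let open CompleteOrderedField ℝ
        open Classical em ℝ
        open Setting using (expectedShuffleSize)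
        open Setting using (Dk)
        open Setting-1/ε using (setting)
        open Setting-1/ε using (D/ε)
    in
    ((S : Setting) → expectedShuffleSize S ≤ c * Dk S * log (Dk S)) ×
    ((λ S → c * Dk S * log (Dk S)) =O (λ S → Dk S * log (Dk S))) ×
    (expectedShuffleSize =O (λ S → Dk S * log (Dk S))) ×
    ((λ S → expectedShuffleSize (setting S)) =O (λ S → D/ε S * log (D/ε S)))
theorem6 em ℝ =
    expectedShuffleSize-≤
  , =O-nonNegative c 0<c 0≤c*Dk*log (λ _ → ≤-reflexive (*-assoc _ _ _))
  , =O-nonNegative c 0<c expectedShuffleSize-nonNegative
      (λ S → ≤-trans (expectedShuffleSize-≤ S) (≤-reflexive (*-assoc _ _ _)))
  -- As `k` equals 1/ε, the bound in `Dk` becomes one in `D/ε` with the same constant `c`;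
  -- `log-cong` carries the change of argument through the logarithm.
  , =O-nonNegative c 0<c (λ S → expectedShuffleSize-nonNegative (setting S))
      (λ S → ≤-trans (expectedShuffleSize-≤ (setting S)) (≤-reflexive
        (trans (*-assoc _ _ _) (*-congˡ (*-cong (Dk≈D/ε S) (log-cong (Dk≈D/ε S)))))))
  where
  open CompleteOrderedField ℝ
  open Classical em ℝ
  open OrderedField ℝ
  open Analysis em ℝ
  open MinHash em ℝ
  open Setting-1/ε using (setting; k≈1/ε; D/ε)

  0<c : 0# < c
  0<c = 0≤n·1 3 , λ 0≈c → 1≤x⇒x≉0 (1≤[1+n]·1 2) (sym 0≈c)

  Dk≈D/ε : ∀ S → Setting.Dk (setting S) ≈ D/ε S
  Dk≈D/ε S = *-congˡ (trans (k≈1/ε S) (*-identityˡ _))
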